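{- There is an absolute constant $C$ such that for every integer $n\ge 3$, every $n$-vertex ordered graph $(G,\prec)$ that is ordered along a Hamiltonian path $P$ and is $2$-non-crossing contains an increasing induced path on at least $\frac{\log n}{2\log\log n}-C$ vertices.
   Context: Graphs are finite and simple. $\log$ is the base-2 logarithm. An ordered graph $(G,\prec)$ is a graph $G$ with a total order $\prec$ on $V(G)$. It is ordered along the Hamiltonian path $P=(v_1,\dots,v_n)$ if $v_1\prec\dots\prec v_n$. A path $(u_1,\dots,u_\ell)$ is increasing if $u_1\prec\dots\prec u_\ell$. A crossing is a pair of edges $ab$, $cd$ with $a\prec c\prec b\prec d$. A set of edges is non-crossing if it contains no crossing. $(G,\prec)$ is $2$-non-crossing if $E(G)$ can be partitioned into two (possibly empty) non-crossing sets. -}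

module Defs where

open import Algebra.Definitions.RawSemiring using () renaming (_^_ to pow)
open import Data.Fin as Fin using (Fin; toℕ)
open import Data.Integer as ℤ using (ℤ; +_; -[1+_])
open import Data.Nat as ℕ using (ℕ; suc)
open import Data.Product using (∃-syntax; _×_)
open import Data.Rational as ℚ using (ℚ; 0ℚ; ½; ↥_; ↧ₙ_; _/_; _*_; _-_; _<_)
open import Data.Sum using (_⊎_)
open import Data.Vec.Functional using (Vector)
open import Function.Bundles using (_↔_)
open import Function.Definitions using (Injective; StrictlySurjective)
open import Level using (0ℓ)
open import Relation.Binary.Core using (Rel; _⇒_)
open import Relation.Binary.Definitions using (Symmetric; Irreflexive; Decidable)
open import Relation.Binary.PropositionalEquality using (_≡_)
open import Relation.Binary.Structures using (IsStrictTotalOrder)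
open import Relation.Nullary using (¬_)
open import Relation.Unary using (Pred; _⊆_)

record OrderedGraph (n : ℕ) : Set₁ where
  infix 4 _~_ _≺_
  field
    V        : Set
    n-vertex : V ↔ Fin n
    _~_      : Rel V 0ℓ
    ~-irrefl : Irreflexive _≡_ _~_
    ~-sym    : Symmetric _~_
    _~?_     : Decidable _~_
    _≺_      : Rel V 0ℓ
    ≺-total  : IsStrictTotalOrder _≡_ _≺_

module _ {n : ℕ} (G : OrderedGraph n) where
  open OrderedGraph G

  Consecutive : ∀ {ℓ} → Rel (Fin ℓ) 0ℓ
  Consecutive i j = toℕ j ≡ suc (toℕ i)

  record IsPath {ℓ : ℕ} (u : Vector V ℓ) : Set where
    field
      nonempty  : 1 ℕ.≤ ℓ
      injective : Injective _≡_ _≡_ u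
      adjacent  : ∀ {i j} → Consecutive i j → u i ~ u j

  record IsInducedPath {ℓ : ℕ} (u : Vector V ℓ) : Set where
    field
      isPath    : IsPath u
      chordless : ∀ {i j} → u i ~ u j → Consecutive i j ⊎ Consecutive j i

  record IsHamiltonianPath (u : Vector V n) : Set where
    field
      isPath   : IsPath u
      spanning : StrictlySurjective _≡_ u

  IsIncreasing : ∀ {ℓ} → Vector V ℓ → Set
  IsIncreasing u = ∀ {i j} → i Fin.< j → u i ≺ u j

  IsOrderedAlong : Vector V n → Set
  IsOrderedAlong P = IsHamiltonianPath P × IsIncreasing P

  -- A set of (undirected) edges is a symmetric subrelation of adjacency, so
  -- each edge may be read with either end first.
  record EdgeSet : Set₁ where
    field
      mem   : Rel V 0ℓ
      sym   : Symmetric mem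
      edges : mem ⇒ _~_
  open EdgeSet

  IsNonCrossing : EdgeSet → Set
  IsNonCrossing S = ∀ {a b c d} → mem S a b → mem S c d →
                    ¬ (a ≺ c × c ≺ b × b ≺ d)

  Is2NonCrossing : Set₁
  Is2NonCrossing =
    ∃[ S ] ∃[ T ]
      (∀ {a b} → a ~ b → mem S a b ⊎ mem T a b) ×
      (∀ {a b} → ¬ (mem S a b × mem T a b)) ×
      IsNonCrossing S × IsNonCrossing T

-- A real x is given by its Dedekind cut: Lower q means q < x and Upper q
-- means x < q, for rational q.  The cut laws are not part of the record; the
-- operations below yield the cut of the stated real number whenever their
-- arguments are cuts of reals in the stated domain.
record Cut : Set₁ where
  field
    Lower : Pred ℚ 0ℓ
    Upper : Pred ℚ 0ℓ
open Cut

infixr 8 _^_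
_^_ : ℚ → ℕ → ℚ
_^_ = pow ℚ.+-*-rawSemiring

2^ : ℤ → ℚ
2^ (+ k)    = (+ 2 / 1) ^ k
2^ -[1+ k ] = ½ ^ suc k

fromℚ : ℚ → Cut
Lower (fromℚ c) q = q < c
Upper (fromℚ c) q = c < q

fromℕ : ℕ → Cut
fromℕ n = fromℚ (+ n / 1)

-- Base-2 logarithm, for x > 0.  With q = a / d, we have q < log₂ x iff
-- 2^a < x^d, iff 2^a < r^d for some rational r with 0 < r < x; dually above.
log₂ : Cut → Cut
Lower (log₂ x) q = ∃[ r ] 0ℚ < r × Lower x r × 2^ (↥ q) < r ^ (↧ₙ q)
Upper (log₂ x) q = ∃[ r ] Upper x r × r ^ (↧ₙ q) < 2^ (↥ q)

infixl 6 _-ᶜ_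
infixl 7 _÷ᶜ_ _·_
infix  4 _≤ᶜ_

-- Scaling, for c > 0.
_·_ : ℚ → Cut → Cut
Lower (c · x) q = ∃[ p ] Lower x p × q < c * p
Upper (c · x) q = ∃[ p ] Upper x p × c * p < q

-- Division, for x ≥ 0 and y > 0.
_÷ᶜ_ : Cut → Cut → Cut
Lower (x ÷ᶜ y) q = ∃[ p ] ∃[ s ] Lower x p × Upper y s × q * s < p
Upper (x ÷ᶜ y) q = ∃[ p ] ∃[ s ] Upper x p × Lower y s × 0ℚ < s × p < q * s

_-ᶜ_ : Cut → Cut → Cut
Lower (x -ᶜ y) q = ∃[ p ] ∃[ s ] Lower x p × Upper y s × q < p - s
Upper (x -ᶜ y) q = ∃[ p ] ∃[ s ] Upper x p × Lower y s × p - s < q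

_≤ᶜ_ : Cut → Cut → Set
x ≤ᶜ y = Lower x ⊆ Lower y

{-# OPTIONS --safe #-}
module Submission where

-- Number the vertices 0, …, n - 1 along P and maintain an interval I together
-- with an increasing induced path ending at some d before I and one starting at
-- some e after I, such that the other vertices of these paths have no neighbours
-- between d and the end of I, respectively between the start of I and e.  Cut I
-- into 2(k + 1) equal blocks.  If d has no neighbour in some block, replace I by
-- this block and extend the first path by the farthest neighbour of d not beyond
-- the block; dually for e.  If both d and e have neighbours in every block, then no
-- edge inside I jumps over two blocks, because the edges at d and e would force a
-- crossing; hence the path that always moves on to the farthest neighbour within I
-- has at least k + 1 vertices.  Otherwise 2k rounds make one of the two paths have
-- k + 1 vertices.  So (2k + 2) ^ (2k) + 2 vertices suffice for an increasing induced
-- path on k + 1 vertices, and the bound follows by taking k maximal.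

-- Increasing induced paths on vertex numbers.

module Chains where

  open import Data.Fin as Fin using (Fin; zero; suc; toℕ; opposite)
  open import Data.Fin.Properties using (opposite-prop; opposite-involutive; toℕ<n)
  open import Data.Nat using
    (ℕ; zero; suc; _+_; _*_; _∸_; _^_; _≤_; _<_; _>_; z≤n; s≤s; z<s; NonZero; >-nonZero⁻¹)
  open import Data.Nat.Properties
  open import Data.Product using (Σ; ∃-syntax; _×_; _,_; proj₁; proj₂)
  open import Data.Sum using (_⊎_; inj₁; inj₂)
  open import Data.Vec.Functional using (Vector; _∷_; [])
  open import Function using (flip; _∘_)
  open import Level using (0ℓ)
  open import Relation.Binary.Core using (Rel)
  open import Relation.Binary.Definitions using (Decidable; Transitive)
  open import Relation.Binary.PropositionalEquality
  open import Relation.Nullary using (¬_; yes; no; contradiction)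
  open import Relation.Nullary.Decidable using (¬?; decidable-stable)
  open import Relation.Unary as Unary using (Pred)

  -- The search runs downwards from `b` and stops at `s` at the latest; it supplies farthest
  -- neighbours ahead.
  greatest : {Q : Pred ℕ 0ℓ} → Unary.Decidable Q → ∀ {s} b → s < b → Q s →
             ∃[ z ] s ≤ z × z < b × Q z × (∀ y → z < y → y < b → ¬ Q y)
  greatest Q? {s} (suc b) (s≤s s≤b) Qs with Q? b
  ... | yes Qb = b , s≤b , ≤-refl , Qb , λ y b<y y<1+b _ → <⇒≱ b<y (≤-pred y<1+b)
  ... | no ¬Qb with m≤n⇒m<n∨m≡n s≤b
  ...   | inj₂ refl = contradiction Qs ¬Qb
  ...   | inj₁ s<b with greatest Q? b s<b Qs
  ...     | z , s≤z , z<b , Qz , max = z , s≤z , m≤n⇒m≤1+n z<b , Qz , max′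
    where
    max′ : ∀ y → z < y → y < suc b → ¬ _
    max′ y z<y y<1+b Qy with m≤n⇒m<n∨m≡n (≤-pred y<1+b)
    ... | inj₁ y<b  = max y z<y y<b Qy
    ... | inj₂ refl = ¬Qb Qy

  least : {Q : Pred ℕ 0ℓ} → Unary.Decidable Q → ∀ {a} k → Q (k + a) →
          ∃[ z ] a ≤ z × z ≤ k + a × Q z × (∀ y → a ≤ y → y < z → ¬ Q y)
  least Q? {a} zero Qa = a , ≤-refl , ≤-refl , Qa , λ y a≤y y<a _ → <⇒≱ y<a a≤y
  least {Q} Q? {a} (suc k) Qs with Q? a
  ... | yes Qa = a , ≤-refl , m≤n+m a (suc k) , Qa , λ y a≤y y<a _ → <⇒≱ y<a a≤y
  ... | no ¬Qa with least Q? {suc a} k (subst Q (sym (+-suc k a)) Qs)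
  ...   | z , a<z , z≤ , Qz , min = z , <⇒≤ a<z , subst (z ≤_) (+-suc k a) z≤ , Qz , min′
    where
    min′ : ∀ y → a ≤ y → y < z → ¬ _
    min′ y a≤y y<z Qy with m≤n⇒m<n∨m≡n a≤y
    ... | inj₁ a<y  = min y a<y y<z Qy
    ... | inj₂ refl = ¬Qa Qy

  block-end : ∀ a i m → a + i * m + m ≡ a + suc i * m
  block-end a i m = trans (+-assoc a (i * m) m) (cong (a +_) (+-comm (i * m) m))

  -- Used with _<_ and the edge relation, and with both of them flipped for paths
  -- that are stored backwards.
  record IsChain (n : ℕ) (_◁_ F : Rel ℕ 0ℓ) {ℓ : ℕ} (u : Vector ℕ ℓ) : Set where
    field
      bounded   : ∀ i → u i < n
      ordered   : ∀ {i j} → i Fin.< j → u i ◁ u j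
      linked    : ∀ {i j} → toℕ j ≡ suc (toℕ i) → F (u i) (u j)
      chordless : ∀ {i j} → i Fin.< j → F (u i) (u j) → toℕ j ≡ suc (toℕ i)
  open IsChain

  module _ {n : ℕ} {_◁_ F : Rel ℕ 0ℓ} where

    singleton : ∀ {x} → x < n → IsChain n _◁_ F (x ∷ [])
    singleton x<n .bounded zero = x<n
    singleton x<n .ordered {zero} {zero} ()
    singleton x<n .linked {zero} {zero} ()
    singleton x<n .chordless {zero} {zero} ()

    cons : Transitive _◁_ → ∀ {ℓ x y} {u : Vector ℕ ℓ} → x < n → x ◁ y → F x y →
           (∀ i → ¬ F x (u i)) → IsChain n _◁_ F (y ∷ u) → IsChain n _◁_ F (x ∷ y ∷ u)
    cons tr x<n x◁y Fxy ¬Fx c .bounded zero = x<n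
    cons tr x<n x◁y Fxy ¬Fx c .bounded (suc i) = c .bounded i
    cons tr x<n x◁y Fxy ¬Fx c .ordered {zero} {suc zero} _ = x◁y
    cons tr x<n x◁y Fxy ¬Fx c .ordered {zero} {suc (suc j)} _ = tr x◁y (c .ordered z<s)
    cons tr x<n x◁y Fxy ¬Fx c .ordered {suc i} {suc j} (s≤s i<j) = c .ordered i<j
    cons tr x<n x◁y Fxy ¬Fx c .linked {zero} {suc zero} _ = Fxy
    cons tr x<n x◁y Fxy ¬Fx c .linked {suc i} {suc j} eq = c .linked (suc-injective eq)
    cons tr x<n x◁y Fxy ¬Fx c .chordless {zero} {suc zero} _ _ = refl
    cons tr x<n x◁y Fxy ¬Fx c .chordless {zero} {suc (suc j)} _ Fxu = contradiction Fxu (¬Fx j)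
    cons tr x<n x◁y Fxy ¬Fx c .chordless {suc i} {suc j} (s≤s i<j) Fuu =
      cong suc (c .chordless i<j Fuu)

    reverse : ∀ {ℓ} {u : Vector ℕ ℓ} → IsChain n (flip _◁_) (flip F) u →
              IsChain n _◁_ F (u ∘ opposite)
    reverse {ℓ} c = record
      { bounded   = λ i → c .bounded (opposite i)
      ; ordered   = λ i<j → c .ordered (opposite-anti i<j)
      ; linked    = λ {i} {j} eq → c .linked (opposite-suc i j eq)
      ; chordless = λ {i} {j} i<j Fuu →
          opposite-suc⁻¹ i j (c .chordless (opposite-anti i<j) Fuu)
      }
      where
      opposite-anti : ∀ {i j : Fin ℓ} → i Fin.< j → opposite j Fin.< opposite i
      opposite-anti {i} {j} i<j rewrite opposite-prop i | opposite-prop j =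
        ∸-monoʳ-< (s≤s i<j) (toℕ<n j)
      opposite-suc : ∀ (i j : Fin ℓ) → toℕ j ≡ suc (toℕ i) → toℕ (opposite i) ≡ suc (toℕ (opposite j))
      opposite-suc i j eq rewrite opposite-prop i | opposite-prop j | eq =
        +-∸-assoc 1 (subst (_< ℓ) eq (toℕ<n j))
      opposite-suc⁻¹ : ∀ (i j : Fin ℓ) → toℕ (opposite i) ≡ suc (toℕ (opposite j)) → toℕ j ≡ suc (toℕ i)
      -- `opposite` is an involution, so the converse is the forward direction at the opposite
      -- indices.
      opposite-suc⁻¹ i j eq = subst₂ (λ x y → toℕ x ≡ suc (toℕ y))
        (opposite-involutive j) (opposite-involutive i) (opposite-suc (opposite j) (opposite i) eq)

  -- Paths in a graph on two non-crossing pages.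

  module _
    {n : ℕ} {E S T : Rel ℕ 0ℓ} (E? : Decidable E)
    (step : ∀ {i} → suc i < n → E i (suc i))
    (cover : ∀ {i j} → E i j → S i j ⊎ T i j)
    (noCrossˢ : ∀ {a b c d} → a < c → c < b → b < d → d < n → S a b → ¬ S c d)
    (noCrossᵗ : ∀ {a b c d} → a < c → c < b → b < d → d < n → T a b → ¬ T c d)
    where

    IncreasingInducedPath : ∀ {ℓ} → Vector ℕ ℓ → Set
    IncreasingInducedPath = IsChain n _<_ E

    -- An increasing induced path ending at d, stored backwards, that can be
    -- continued at d into the interval (d , b) without creating chords.
    Into : ℕ → ℕ → ℕ → Set
    Into p d b = Σ (Vector ℕ p) λ u → IsChain n _>_ (flip E) (d ∷ u) ×
      (∀ i z → d < z → z < b → ¬ E (u i) z)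

    -- The mirror image: an increasing induced path starting at e that can be
    -- continued at e backwards into [a , e).
    OutOf : ℕ → ℕ → ℕ → Set
    OutOf q e a = Σ (Vector ℕ q) λ u → IsChain n _<_ E (e ∷ u) ×
      (∀ i z → a ≤ z → z < e → ¬ E z (u i))

    into-shrink : ∀ {p d b b′} → b′ ≤ b → Into p d b → Into p d b′
    into-shrink b′≤b (u , c , free) = u , c , λ i z d<z z<b′ → free i z d<z (<-≤-trans z<b′ b′≤b)

    outOf-shrink : ∀ {q e a a′} → a ≤ a′ → OutOf q e a → OutOf q e a′
    outOf-shrink a≤a′ (u , c , free) = u , c , λ i z a′≤z → free i z (≤-trans a≤a′ a′≤z)

    -- Moving to the farthest neighbour below b leaves d without neighbours ahead.
    into-extend : ∀ {p d b} → suc d < b → b ≤ n → Into p d b →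
                  ∃[ d′ ] d < d′ × d′ < b × E d d′ × Into (suc p) d′ b
    into-extend {p} {d} {b} 1+d<b b≤n (u , c , free)
      with greatest (E? d) b 1+d<b (step (<-≤-trans 1+d<b b≤n))
    ... | d′ , d<d′ , d′<b , Edd′ , last =
      d′ , d<d′ , d′<b , Edd′ , d ∷ u ,
      cons (flip <-trans) (<-≤-trans d′<b b≤n) d<d′ Edd′ (λ i → free i d′ d<d′ d′<b) c ,
      λ { zero → last ; (suc i) z d′<z → free i z (<-trans d<d′ d′<z) }

    outOf-extend : ∀ {q e a} → a < e → OutOf q e a →
                   ∃[ e′ ] a ≤ e′ × e′ < e × E e′ e × OutOf (suc q) e′ a
    outOf-extend {q} {suc e₀} {a} (s≤s a≤e₀) (u , c , free)
      -- The predecessor `e₀` is adjacent to `suc e₀` along the Hamiltonian path, so the search from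
      -- `a` finds a neighbour.
      with least (λ z → E? z (suc e₀)) (e₀ ∸ a)
                 (subst (λ z → E z (suc e₀)) (sym (m∸n+n≡m a≤e₀)) (step (c .bounded zero)))
    ... | e′ , a≤e′ , e′≤ , Ee′e , first =
      e′ , a≤e′ , e′<e , Ee′e , suc e₀ ∷ u ,
      cons <-trans (<-trans e′<e (c .bounded zero)) e′<e Ee′e (λ i → free i e′ a≤e′ e′<e) c ,
      λ { zero → first ; (suc i) z a≤z z<e′ → free i z a≤z (<-trans z<e′ e′<e) }
      where
      e′<e : e′ < suc e₀
      e′<e = s≤s (≤-trans e′≤ (≤-reflexive (m∸n+n≡m a≤e₀)))

    LongPath : ℕ → Set
    LongPath k = ∃[ ℓ ] k ≤ ℓ × Σ (Vector ℕ (suc ℓ)) IncreasingInducedPath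

    -- Each edge from d or e to a vertex between u and v crosses uv, so d y and x e
    -- would both lie on the page that does not contain uv; but they cross each other.
    no-jump : ∀ {d e u v x y} → d < u → u < x → x < y → y < v → v < e → e < n →
              E d y → E x e → ¬ E u v
    no-jump d<u u<x x<y y<v v<e e<n Edy Exe Euv with cover Euv | cover Edy | cover Exe
    ... | inj₁ Suv | inj₁ Sdy | _        = noCrossˢ d<u (<-trans u<x x<y) y<v (<-trans v<e e<n) Sdy Suv
    ... | inj₁ Suv | inj₂ _   | inj₁ Sxe = noCrossˢ u<x (<-trans x<y y<v) v<e e<n Suv Sxe
    ... | inj₁ Suv | inj₂ Tdy | inj₂ Txe = noCrossᵗ (<-trans d<u u<x) x<y (<-trans y<v v<e) e<n Tdy Txe
    ... | inj₂ Tuv | inj₂ Tdy | _        = noCrossᵗ d<u (<-trans u<x x<y) y<v (<-trans v<e e<n) Tdy Tuv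
    ... | inj₂ Tuv | inj₁ _   | inj₂ Txe = noCrossᵗ u<x (<-trans x<y y<v) v<e e<n Tuv Txe
    ... | inj₂ Tuv | inj₁ Sdy | inj₁ Sxe = noCrossˢ (<-trans d<u u<x) x<y (<-trans y<v v<e) e<n Sdy Sxe

    module _ (k : ℕ) where

      K : ℕ
      K = suc k * 2

      -- The interval is [a, a + K ^ j): `j` counts the cuts still possible, and `s` the vertices on
      -- the two paths besides their ends `d` and `e`.
      record State (j s : ℕ) : Set where
        field
          {d a e p q} : ℕ
          d<a   : d < a
          fits  : a + K ^ j ≤ e
          into  : Into p d (a + K ^ j)
          outOf : OutOf q e a
          total : p + q ≡ s

      -- By `no-jump` a greedy step cannot clear both of the next two blocks, so `r` steps from `a`
      -- stay within the first 2r + 1 blocks and all `k` steps fit into the interval.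
      greedy : ∀ {a d e m} .{{_ : NonZero m}} → d < a → a + K * m ≤ e → e < n →
               (∀ {i} → i < K → ∃[ t ] t < m × E d (a + i * m + t)) →
               (∀ {i} → i < K → ∃[ t ] t < m × E (a + i * m + t) e) →
               LongPath k
      greedy {a} {d} {e} {m} d<a fits e<n hitᵈ hitᵉ = k , ≤-refl , path
        where
        b : ℕ
        b = a + K * m
        0<m : 0 < m
        0<m = >-nonZero⁻¹ m
        block-< : ∀ i {t} → t < m → a + i * m + t < a + suc i * m
        block-< i {t} t<m = subst (a + i * m + t <_) (block-end a i m) (+-monoʳ-< (a + i * m) t<m)
        odd<K : ∀ {r} → r < k → suc (r * 2) < K
        odd<K r<k = s≤s (s≤s (*-monoˡ-≤ 2 (<⇒≤ r<k)))
        even<K : ∀ {r} → r < k → suc r * 2 < K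
        even<K r<k = s≤s (≤-trans (*-monoˡ-≤ 2 r<k) (n≤1+n _))
        climb : ∀ r → r ≤ k → ∃[ h ] a ≤ h × h < a + suc (r * 2) * m × Into r h b
        climb zero _ = a , ≤-refl , m<m+n a (+-monoˡ-< 0 0<m) ,
          [] , singleton (≤-<-trans (m≤m+n a (K * m)) (≤-<-trans fits e<n)) , λ ()
        climb (suc r) r<k with climb r (<⇒≤ r<k)
        ... | h , a≤h , h< , into with into-extend
          (≤-<-trans h< (+-monoʳ-< a (*-monoˡ-< m (odd<K r<k)))) (≤-trans fits (<⇒≤ e<n)) into
        ...   | h′ , h<h′ , h′<b , Ehh′ , into′ with h′ <? a + suc (suc r * 2) * m
        ...     | yes h′< = h′ , ≤-trans a≤h (<⇒≤ h<h′) , h′< , into′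
        -- Here `h` lies before block 2r + 1 and `h′` after block 2r + 2. Taking the neighbour of
        -- `e` from the former and that of `d` from the latter puts them in the order that `no-jump`
        -- requires.
        ...     | no h′≮ with hitᵉ (odd<K r<k) | hitᵈ (even<K r<k)
        ...       | t , t<m , Exe | t′ , t′<m , Edy = contradiction Ehh′
          (no-jump (<-≤-trans d<a a≤h)
            (<-≤-trans h< (m≤m+n _ t))
            (<-≤-trans (block-< (suc (r * 2)) t<m) (m≤m+n _ t′))
            (<-≤-trans (block-< (suc r * 2) t′<m) (≮⇒≥ h′≮))
            (<-≤-trans h′<b fits) e<n Edy Exe)
        path : Σ (Vector ℕ (suc k)) IncreasingInducedPath
        path with climb k ≤-refl
        ... | h , _ , _ , u , c , _ = _ , reverse c

      -- A round either finishes by `greedy` or spends one factor `K` of the interval length on one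
      -- more path vertex.
      advance : ∀ {j s} → State (suc j) s → LongPath k ⊎ State j (suc s)
      advance {j} {s} record { d = d ; a = a ; e = e ; p = p ; q = q ; d<a = d<a ; fits = fits
                         ; into = into ; outOf = outOf ; total = total } = cases
        where
        m : ℕ
        m = K ^ j
        instance
          m≢0 : NonZero m
          m≢0 = m^n≢0 K j
        0<m : 0 < m
        0<m = >-nonZero⁻¹ m
        e<n : e < n
        e<n = proj₁ (proj₂ outOf) .bounded zero
        start≤ : ∀ i → a ≤ a + i * m
        start≤ i = m≤m+n a (i * m)
        end≤ : ∀ {i} → i < K → a + i * m + m ≤ a + K * m
        end≤ {i} i<K = ≤-trans (≤-reflexive (block-end a i m)) (+-monoʳ-≤ a (*-monoˡ-≤ m i<K))

        Hitᵈ Hitᵉ : ℕ → Set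
        Hitᵈ i = ∃[ t ] t < m × E d (a + i * m + t)
        Hitᵉ i = ∃[ t ] t < m × E (a + i * m + t) e
        hitᵈ? : Unary.Decidable Hitᵈ
        hitᵈ? i = anyUpTo? (λ t → E? d (a + i * m + t)) m
        hitᵉ? : Unary.Decidable Hitᵉ
        hitᵉ? i = anyUpTo? (λ t → E? (a + i * m + t) e) m

        offset : ∀ {z c} → c ≤ z → z < c + m → ∃[ t ] t < m × c + t ≡ z
        offset {z} {c} c≤z z<c+m = z ∸ c ,
          +-cancelˡ-< c (z ∸ c) m (subst (_< c + m) (sym (m+[n∸m]≡n c≤z)) z<c+m) , m+[n∸m]≡n c≤z

        extend-into : ∀ {i} → i < K → ¬ Hitᵈ i → State j (suc s)
        extend-into {i} i<K miss with into-extend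
          (≤-<-trans (≤-trans d<a (start≤ i)) (m<m+n (a + i * m) 0<m))
          (≤-trans (end≤ i<K) (≤-trans fits (<⇒≤ e<n)))
          (into-shrink (end≤ i<K) into)
        ... | d′ , d<d′ , d′< , Edd′ , into′ = record
          -- The farthest neighbour of `d` below the end of the missed block cannot lie in the
          -- block, so it lies before it.
          { d<a   = ≰⇒> λ a′≤d′ → let t , t<m , eq = offset a′≤d′ d′< in
                      miss (t , t<m , subst (E d) (sym eq) Edd′)
          ; fits  = ≤-trans (end≤ i<K) fits
          ; into  = into′
          ; outOf = outOf-shrink (start≤ i) outOf
          ; total = cong suc total
          }

        extend-outOf : ∀ {i} → i < K → ¬ Hitᵉ i → State j (suc s)
        extend-outOf {i} i<K miss with outOf-extend
          (<-≤-trans (m<m+n (a + i * m) 0<m) (≤-trans (end≤ i<K) fits))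
          (outOf-shrink (start≤ i) outOf)
        ... | e′ , a′≤e′ , e′<e , Ee′e , outOf′ = record
          { d<a   = <-≤-trans d<a (start≤ i)
          -- Dually, the first neighbour of `e` from the start of the missed block on lies at or
          -- beyond its end.
          ; fits  = ≮⇒≥ λ e′< → let t , t<m , eq = offset a′≤e′ e′< in
                      miss (t , t<m , subst (λ z → E z e) (sym eq) Ee′e)
          ; into  = into-shrink (end≤ i<K) into
          ; outOf = outOf′
          ; total = trans (+-suc p q) (cong suc total)
          }

        cases : LongPath k ⊎ State j (suc s)
        cases with anyUpTo? (¬? ∘ hitᵈ?) K
        ... | yes (i , i<K , miss) = inj₂ (extend-into i<K miss)
        ... | no allᵈ with anyUpTo? (¬? ∘ hitᵉ?) K
        ...   | yes (i , i<K , miss) = inj₂ (extend-outOf i<K miss)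
        ...   | no allᵉ = inj₁ (greedy d<a fits e<n
          (λ {i} i<K → decidable-stable (hitᵈ? i) λ miss → allᵈ (i , i<K , miss))
          (λ {i} i<K → decidable-stable (hitᵉ? i) λ miss → allᵉ (i , i<K , miss)))

      -- Each round lowers the level by one and raises the vertex count by one, so j + s is
      -- preserved.
      iterate : ∀ {j s} → State j s → LongPath k ⊎ State 0 (j + s)
      iterate {zero} st = inj₂ st
      iterate {suc j} {s} st with advance st
      ... | inj₁ path = inj₁ path
      ... | inj₂ st′  = subst (λ t → LongPath k ⊎ State 0 t) (+-suc j s) (iterate st′)

      -- The interval starts at 1, between `d` = 0 and `e` = 1 + K ^ j; these two ends account for
      -- the summand 2.
      initial : ∀ {j} → 2 + K ^ j ≤ n → State j 0
      initial {j} 2+Kʲ≤n = record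
        { d<a   = z<s
        ; fits  = ≤-refl
        ; into  = [] , singleton (≤-trans (s≤s z≤n) 2+Kʲ≤n) , λ ()
        ; outOf = [] , singleton 2+Kʲ≤n , λ ()
        ; total = refl
        }

      longPath : 2 + K ^ (k * 2) ≤ n → LongPath k
      longPath big with iterate (initial big)
      ... | inj₁ path = path
      ... | inj₂ record { p = p ; q = q ; into = u , c , _ ; outOf = v , c′ , _ ; total = total }
        with k ≤? p
      ...   | yes k≤p = p , k≤p , _ , reverse c
      ...   | no k≰p = q , k≤q , _ , c′
        where
        open ≤-Reasoning
        k≤q : k ≤ q
        k≤q = +-cancelˡ-≤ k k q (begin
          k + k       ≡⟨ cong (k +_) (+-identityʳ k) ⟨
          2 * k       ≡⟨ *-comm 2 k ⟩
          k * 2       ≡⟨ +-identityʳ (k * 2) ⟨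
          k * 2 + 0   ≡⟨ total ⟨
          p + q       ≤⟨ +-monoˡ-≤ q (<⇒≤ (≰⇒> k≰p)) ⟩
          k + q       ∎)

open import Defs

-- Powers of rationals and the embedding of the naturals.

module Logarithms where

  open import Algebra.Bundles using (CommutativeRing)
  import Algebra.Properties.CommutativeSemiring.Exp as Exp
  open import Data.Integer as ℤ using (+_; -[1+_])
  import Data.Integer.Properties as ℤ
  open import Data.Nat as ℕ using (ℕ; zero; suc; z≤n; s≤s)
  import Data.Nat.Coprimality as Coprimality
  import Data.Nat.Properties as ℕ
  open import Data.Product using (∃-syntax; _×_; _,_; proj₁; proj₂)
  open import Data.Rational as ℚ using
    ( ℚ; mkℚ; 0ℚ; 1ℚ; ½; _/_; _+_; _*_; _-_; _<_; _≤_; *≤*; ↥_; ↧ₙ_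
    ; Positive; nonNegative; positive )
  import Data.Rational.Properties as ℚ
  open import Data.Rational.Solver using (module +-*-Solver)
  import Data.Rational.Unnormalised as ℚᵘ
  import Data.Rational.Unnormalised.Properties as ℚᵘ
  open import Level using (0ℓ)
  open import Relation.Binary.PropositionalEquality
  open import Relation.Nullary using (¬_; yes; no; contradiction)
  open import Relation.Unary as Unary using (Pred)

  open +-*-Solver using (solve; _:=_; _:*_)
  open Exp (CommutativeRing.commutativeSemiring ℚ.+-*-commutativeRing)
    using (^-assocʳ; ^-distrib-*)

  ≤⇒≯ : ∀ {p q} → p ≤ q → ¬ q < p
  ≤⇒≯ p≤q q<p = ℚ.<-irrefl refl (ℚ.≤-<-trans p≤q q<p)

  ι : ℕ → ℚ
  ι n = + n / 1

  -- `_/_` normalises by a gcd that is stuck on a variable; rewriting with the normal form lets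
  -- rational arithmetic compute.
  ι≡mkℚ : ∀ n → ι n ≡ mkℚ (+ n) 0 (Coprimality.sym (Coprimality.1-coprimeTo n))
  ι≡mkℚ n = ℚ.normalize-coprime (Coprimality.sym (Coprimality.1-coprimeTo n))

  ι-* : ∀ m n → ι (m ℕ.* n) ≡ ι m * ι n
  ι-* m n rewrite ι≡mkℚ m | ι≡mkℚ n = cong (_/ 1) (ℤ.pos-* m n)

  ι-+ : ∀ m n → ι (m ℕ.+ n) ≡ ι m + ι n
  ι-+ m n rewrite ι≡mkℚ m | ι≡mkℚ n =
    cong (_/ 1) (sym (cong₂ ℤ._+_ (ℤ.*-identityʳ (+ m)) (ℤ.*-identityʳ (+ n))))

  ι-mono-≤ : ∀ {m n} → m ℕ.≤ n → ι m ≤ ι n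
  ι-mono-≤ {m} {n} m≤n rewrite ι≡mkℚ m | ι≡mkℚ n =
    *≤* (ℤ.*-monoʳ-≤-nonNeg (+ 1) (ℤ.+≤+ m≤n))

  ι-cancel-< : ∀ {m n} → ι m < ι n → m ℕ.< n
  ι-cancel-< {m} {n} ιm<ιn with m ℕ.<? n
  ... | yes m<n = m<n
  ... | no m≮n  = contradiction ιm<ιn (≤⇒≯ (ι-mono-≤ (ℕ.≮⇒≥ m≮n)))

  ι-^ : ∀ m k → ι (m ℕ.^ k) ≡ ι m ^ k
  ι-^ m zero    = refl
  ι-^ m (suc k) = trans (ι-* m (m ℕ.^ k)) (cong (ι m *_) (ι-^ m k))

  0≤ι : ∀ n → 0ℚ ≤ ι n
  0≤ι n = ι-mono-≤ {0} {n} ℕ.z≤n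

  -- This brings inequalities between fractions down to natural numbers.
  clear-denominator : ∀ u d-1 .(c : Coprimality.Coprime u (suc d-1)) →
                      mkℚ (+ u) d-1 c * ι (suc d-1) ≡ ι u
  clear-denominator u d-1 c rewrite ι≡mkℚ (suc d-1) | ι≡mkℚ u =
    ℚ.toℚᵘ-injective (ℚᵘ.≃-trans
      (ℚ.toℚᵘ-homo-* (mkℚ (+ u) d-1 c)
        (mkℚ (+ suc d-1) 0 (Coprimality.sym (Coprimality.1-coprimeTo (suc d-1)))))
      (ℚᵘ.*≡* (ℤ.*-assoc (+ u) (+ suc d-1) (+ 1))))

  *-mono-≤ : ∀ {p q r s} → 0ℚ ≤ p → 0ℚ ≤ r → p ≤ q → r ≤ s → p * r ≤ q * s
  *-mono-≤ {p} {q} {r} {s} 0≤p 0≤r p≤q r≤s = ℚ.≤-trans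
    (ℚ.*-monoʳ-≤-nonNeg r {{nonNegative 0≤r}} p≤q)
    (ℚ.*-monoˡ-≤-nonNeg q {{nonNegative (ℚ.≤-trans 0≤p p≤q)}} r≤s)

  ^-nonNeg : ∀ {p} k → 0ℚ ≤ p → 0ℚ ≤ p ^ k
  ^-nonNeg zero    0≤p = 0≤ι 1
  ^-nonNeg (suc k) 0≤p = *-mono-≤ ℚ.≤-refl ℚ.≤-refl 0≤p (^-nonNeg k 0≤p)

  ^-monoˡ-≤ : ∀ {p q} k → 0ℚ ≤ p → p ≤ q → p ^ k ≤ q ^ k
  ^-monoˡ-≤ zero    0≤p p≤q = ℚ.≤-refl
  ^-monoˡ-≤ (suc k) 0≤p p≤q = *-mono-≤ 0≤p (^-nonNeg k 0≤p) p≤q (^-monoˡ-≤ k 0≤p p≤q)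

  ^-monoˡ-< : ∀ {p q} k → 0ℚ ≤ p → p < q → p ^ suc k < q ^ suc k
  ^-monoˡ-< {p} {q} k 0≤p p<q = ℚ.≤-<-trans
    (ℚ.*-monoˡ-≤-nonNeg p {{nonNegative 0≤p}} (^-monoˡ-≤ k 0≤p (ℚ.<⇒≤ p<q)))
    (ℚ.*-monoˡ-<-pos (q ^ k) {{positive (pos k)}} p<q)
    where
    0<q : 0ℚ < q
    0<q = ℚ.≤-<-trans 0≤p p<q
    pos : ∀ k → 0ℚ < q ^ k
    pos zero    = ℚ.positive⁻¹ 1ℚ
    pos (suc k) = subst (_< q * q ^ k) (ℚ.*-zeroʳ q) (ℚ.*-monoʳ-<-pos q {{positive 0<q}} (pos k))

  1≤^ : ∀ {p} k → 1ℚ ≤ p → 1ℚ ≤ p ^ k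
  1≤^ zero    1≤p = ℚ.≤-refl
  1≤^ (suc k) 1≤p = *-mono-≤ (0≤ι 1) (0≤ι 1) 1≤p (1≤^ k 1≤p)

  -- Negative powers of 2 are at most 1. Hence a fraction above the logarithm of a number that is at
  -- least 1 has a natural numerator.
  1<2^⇒nonNeg : ∀ z → 1ℚ < 2^ z → ∃[ u ] z ≡ + u
  1<2^⇒nonNeg (+ u)    _ = u , refl
  1<2^⇒nonNeg -[1+ k ] 1<½^ = contradiction 1<½^ (≤⇒≯ (½^≤1 (suc k)))
    where
    0≤½ : 0ℚ ≤ ½
    0≤½ = ℚ.nonNegative⁻¹ ½
    ½^≤1 : ∀ k → ½ ^ k ≤ 1ℚ
    ½^≤1 zero    = ℚ.≤-refl
    ½^≤1 (suc k) = *-mono-≤ {½} {1ℚ} {½ ^ k} {1ℚ} 0≤½ (^-nonNeg k 0≤½) (ℚ.≤ᵇ⇒≤ _) (½^≤1 k)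

  -- Comparing cuts of logarithms through powers.

  Positive-ι : ∀ m .{{_ : ℕ.NonZero m}} → Positive (ι m)
  Positive-ι m = ℚ.normalize-pos m 1

  -- In logarithms, w ≤ 2 log n and d log n < u. Without them, 2u < wd is refuted by 2^(wd) ≤ n^(2d)
  -- < 2^(2u).
  exponent-≤ : ∀ n w d u .{{_ : ℕ.NonZero d}} → 2 ℕ.^ w ℕ.≤ n ℕ.^ 2 → n ℕ.^ d ℕ.< 2 ℕ.^ u →
               w ℕ.* d ℕ.≤ 2 ℕ.* u
  exponent-≤ n w d u 2^w≤n² n^d<2^u = ℕ.≮⇒≥ λ 2u<wd → ℕ.<-asym 2^wd<2^2u (ℕ.^-monoʳ-< 2 ℕ.≤-refl 2u<wd)
    where
    open ℕ.≤-Reasoning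
    2^wd<2^2u : 2 ℕ.^ (w ℕ.* d) ℕ.< 2 ℕ.^ (2 ℕ.* u)
    2^wd<2^2u = begin-strict
      2 ℕ.^ (w ℕ.* d)    ≡⟨ ℕ.^-*-assoc 2 w d ⟨
      (2 ℕ.^ w) ℕ.^ d    ≤⟨ ℕ.^-monoˡ-≤ d 2^w≤n² ⟩
      (n ℕ.^ 2) ℕ.^ d    ≡⟨ ℕ.^-*-assoc n 2 d ⟩
      n ℕ.^ (2 ℕ.* d)    ≡⟨ cong (n ℕ.^_) (ℕ.*-comm 2 d) ⟩
      n ℕ.^ (d ℕ.* 2)    ≡⟨ ℕ.^-*-assoc n d 2 ⟨
      (n ℕ.^ d) ℕ.^ 2    <⟨ ℕ.^-monoˡ-< 2 n^d<2^u ⟩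
      (2 ℕ.^ u) ℕ.^ 2    ≡⟨ ℕ.^-*-assoc 2 u 2 ⟩
      2 ℕ.^ (u ℕ.* 2)    ≡⟨ cong (2 ℕ.^_) (ℕ.*-comm u 2) ⟩
      2 ℕ.^ (2 ℕ.* u)    ∎

  -- For r = u / d, membership in the upper cut gives n^d < 2^u, and `exponent-≤` then bounds wd by
  -- 2u.
  log₂-lower : ∀ n w r → 1 ℕ.≤ n → 2 ℕ.^ w ℕ.≤ n ℕ.^ 2 →
               Cut.Upper (log₂ (fromℕ n)) r → ι w ≤ ι 2 * r
  log₂-lower n w (mkℚ z d-1 c) 1≤n 2^w≤n² (r′ , n<r′ , r′^d<2^z)
    with 1<2^⇒nonNeg z (ℚ.≤-<-trans
           (1≤^ (suc d-1) (ℚ.≤-trans (ι-mono-≤ {1} {n} 1≤n) (ℚ.<⇒≤ n<r′))) r′^d<2^z)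
  ... | u , refl = ℚ.*-cancelʳ-≤-pos (ι d) {{Positive-ι d}} (begin
      ι w * ι d             ≡⟨ ι-* w d ⟨
      ι (w ℕ.* d)           ≤⟨ ι-mono-≤ (exponent-≤ n w d u 2^w≤n² n^d<2^u) ⟩
      ι (2 ℕ.* u)           ≡⟨ ι-* 2 u ⟩
      ι 2 * ι u             ≡⟨ cong (ι 2 *_) (clear-denominator u d-1 c) ⟨
      ι 2 * (r * ι d)       ≡⟨ ℚ.*-assoc (ι 2) r (ι d) ⟨
      ι 2 * r * ι d         ∎)
    where
    open ℚ.≤-Reasoning
    d = suc d-1
    r = mkℚ (+ u) d-1 c
    n^d<2^u : n ℕ.^ d ℕ.< 2 ℕ.^ u
    n^d<2^u = ι-cancel-< (begin-strict
      ι (n ℕ.^ d)  ≡⟨ ι-^ n d ⟩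
      ι n ^ d      ≤⟨ ^-monoˡ-≤ d (0≤ι n) (ℚ.<⇒≤ n<r′) ⟩
      r′ ^ d       <⟨ r′^d<2^z ⟩
      ι 2 ^ u      ≡⟨ ι-^ 2 u ⟨
      ι (2 ℕ.^ u)  ∎)

  2^-mono-≤ : ∀ {j k} → j ℕ.≤ k → ι 2 ^ j ≤ ι 2 ^ k
  2^-mono-≤ {j} {k} j≤k = subst₂ _≤_ (ι-^ 2 j) (ι-^ 2 k) (ι-mono-≤ (ℕ.^-monoʳ-≤ 2 j≤k))

  -- The reason is log n ≤ N log r ≤ N t. For t = a / b and p = c / e, raising to the power eb turns
  -- N t < p into n^(eb) < n^(eb).
  log₂-upper : ∀ n N r t {p} → 1ℚ ≤ r → ι n ≤ r ^ N → r ^ (↧ₙ t) < 2^ (↥ t) →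
               Cut.Lower (log₂ (fromℕ n)) p → 0ℚ ≤ t × p ≤ ι N * t
  log₂-upper n N r (mkℚ z b-1 z⊥b) {p} 1≤r n≤r^N r^b<2^z (x , 0<x , x<n , 2^p<x^e)
    with 1<2^⇒nonNeg z (ℚ.≤-<-trans (1≤^ (suc b-1) 1≤r) r^b<2^z)
  ... | a , refl = 0≤t , p≤Nt p 2^p<x^e
    where
    open ℚ.≤-Reasoning
    b = suc b-1
    t = mkℚ (+ a) b-1 z⊥b
    0≤r : 0ℚ ≤ r
    0≤r = ℚ.≤-trans (0≤ι 1) 1≤r
    0≤t : 0ℚ ≤ t
    0≤t = ℚ.nonNegative⁻¹ t
    0≤Nt : 0ℚ ≤ ι N * t
    0≤Nt = *-mono-≤ ℚ.≤-refl ℚ.≤-refl (0≤ι N) 0≤t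

    p≤Nt : ∀ p → 2^ (↥ p) < x ^ (↧ₙ p) → p ≤ ι N * t
    p≤Nt p@(mkℚ -[1+ _ ] _ _) _ = ℚ.≤-trans (ℚ.<⇒≤ (ℚ.negative⁻¹ p)) 0≤Nt
    p≤Nt p@(mkℚ (+ c) e-1 c⊥e) 2^c<x^e = ℚ.≮⇒≥ λ Nt<p → ℚ.<-irrefl refl (begin-strict
      ι n ^ (e ℕ.* b)             ≤⟨ ^-monoˡ-≤ (e ℕ.* b) (0≤ι n) n≤r^N ⟩
      (r ^ N) ^ (e ℕ.* b)         ≡⟨ ^-assocʳ r N (e ℕ.* b) ⟩
      r ^ (N ℕ.* (e ℕ.* b))       ≡⟨ cong (r ^_) (trans (sym (ℕ.*-assoc N e b)) (ℕ.*-comm (N ℕ.* e) b)) ⟩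
      r ^ (b ℕ.* (N ℕ.* e))       ≡⟨ ^-assocʳ r b (N ℕ.* e) ⟨
      (r ^ b) ^ (N ℕ.* e)         ≤⟨ ^-monoˡ-≤ (N ℕ.* e) (^-nonNeg b 0≤r) (ℚ.<⇒≤ r^b<2^z) ⟩
      (ι 2 ^ a) ^ (N ℕ.* e)       ≡⟨ ^-assocʳ (ι 2) a (N ℕ.* e) ⟩
      ι 2 ^ (a ℕ.* (N ℕ.* e))     ≤⟨ 2^-mono-≤ (ℕ.<⇒≤ (aNe<cb Nt<p)) ⟩
      ι 2 ^ (c ℕ.* b)             ≡⟨ ^-assocʳ (ι 2) c b ⟨
      (ι 2 ^ c) ^ b               <⟨ ^-monoˡ-< b-1 (^-nonNeg c (0≤ι 2)) 2^c<x^e ⟩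
      (x ^ e) ^ b                 ≤⟨ ^-monoˡ-≤ b (^-nonNeg e (ℚ.<⇒≤ 0<x)) (^-monoˡ-≤ e (ℚ.<⇒≤ 0<x) (ℚ.<⇒≤ x<n)) ⟩
      (ι n ^ e) ^ b               ≡⟨ ^-assocʳ (ι n) e b ⟩
      ι n ^ (e ℕ.* b)             ∎)
      where
      e = suc e-1
      aNe<cb : ι N * t < p → a ℕ.* (N ℕ.* e) ℕ.< c ℕ.* b
      aNe<cb Nt<p = ι-cancel-< (begin-strict
        ι (a ℕ.* (N ℕ.* e))       ≡⟨ ι-* a (N ℕ.* e) ⟩
        ι a * ι (N ℕ.* e)         ≡⟨ cong₂ _*_ (sym (clear-denominator a b-1 z⊥b)) (ι-* N e) ⟩
        t * ι b * (ι N * ι e)     ≡⟨ rearrange t (ι b) (ι N) (ι e) ⟩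
        ι N * t * ι e * ι b       <⟨ ℚ.*-monoˡ-<-pos (ι b) {{Positive-ι b}} (ℚ.*-monoˡ-<-pos (ι e) {{Positive-ι e}} Nt<p) ⟩
        p * ι e * ι b             ≡⟨ cong (_* ι b) (clear-denominator c e-1 c⊥e) ⟩
        ι c * ι b                 ≡⟨ ι-* c b ⟨
        ι (c ℕ.* b)               ∎)
        where
        rearrange : ∀ t b N e → t * b * (N * e) ≡ N * t * e * b
        rearrange = solve 4 (λ t b N e → t :* b :* (N :* e) := N :* t :* e :* b) refl

  -- A rational r above log n satisfies r ≥ w / 2, hence n ≤ (w / 2)^(2M) ≤ r^(2M). Any t above log
  -- r then gives log n ≤ 2Mt, and since s exceeds 2t, no p > M has p s below log n.
  ratio-upper : ∀ n w M {p} → 1 ℕ.≤ n → 2 ℕ.≤ w → 2 ℕ.^ w ℕ.≤ n ℕ.^ 2 →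
                n ℕ.* 2 ℕ.^ (M ℕ.* 2) ℕ.≤ w ℕ.^ (M ℕ.* 2) →
                Cut.Lower (log₂ (fromℕ n) ÷ᶜ (ι 2 · log₂ (log₂ (fromℕ n)))) p → p ≤ ι M
  ratio-upper n w M {p} 1≤n 2≤w 2^w≤n² n2^N≤w^N
    (y , s , y<log , (t , (r , log<r , r^b<2^a) , 2t<s) , ps<y) = ℚ.≮⇒≥ λ M<p → ℚ.<-irrefl refl (begin-strict
      ι N * t            ≡⟨ cong (_* t) (ι-* M 2) ⟩
      ι M * ι 2 * t      ≡⟨ ℚ.*-assoc (ι M) (ι 2) t ⟩
      ι M * (ι 2 * t)    ≤⟨ *-mono-≤ (0≤ι M) 0≤2t (ℚ.<⇒≤ M<p) (ℚ.<⇒≤ 2t<s) ⟩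
      p * s              <⟨ ps<y ⟩
      y                  ≤⟨ proj₂ bounds ⟩
      ι N * t            ∎)
    where
    open ℚ.≤-Reasoning
    N = M ℕ.* 2
    w≤2r : ι w ≤ ι 2 * r
    w≤2r = log₂-lower n w r 1≤n 2^w≤n² log<r
    1≤r : 1ℚ ≤ r
    1≤r = ℚ.*-cancelˡ-≤-pos (ι 2) (ℚ.≤-trans (ι-mono-≤ 2≤w) w≤2r)
    n≤r^N : ι n ≤ r ^ N
    -- The factor 2^N on both sides avoids halving `w`.
    n≤r^N = ℚ.*-cancelʳ-≤-pos (ι (2 ℕ.^ N)) {{Positive-ι (2 ℕ.^ N) {{ℕ.m^n≢0 2 N}}}} (begin
      ι n * ι (2 ℕ.^ N)    ≡⟨ ι-* n (2 ℕ.^ N) ⟨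
      ι (n ℕ.* 2 ℕ.^ N)    ≤⟨ ι-mono-≤ n2^N≤w^N ⟩
      ι (w ℕ.^ N)          ≡⟨ ι-^ w N ⟩
      ι w ^ N              ≤⟨ ^-monoˡ-≤ N (0≤ι w) w≤2r ⟩
      (ι 2 * r) ^ N        ≡⟨ ^-distrib-* (ι 2) r N ⟩
      ι 2 ^ N * r ^ N      ≡⟨ ℚ.*-comm (ι 2 ^ N) (r ^ N) ⟩
      r ^ N * ι 2 ^ N      ≡⟨ cong (r ^ N *_) (ι-^ 2 N) ⟨
      r ^ N * ι (2 ℕ.^ N)  ∎)
    bounds : 0ℚ ≤ t × y ≤ ι N * t
    bounds = log₂-upper n N r t 1≤r n≤r^N r^b<2^a y<log
    0≤2t : 0ℚ ≤ ι 2 * t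
    0≤2t = *-mono-≤ ℚ.≤-refl ℚ.≤-refl (0≤ι 2) (proj₁ bounds)

  -- Choosing k and estimating log n in terms of it.

  crossover : {Q : Pred ℕ 0ℓ} → Unary.Decidable Q → Q 0 → ∀ m → ¬ Q m → ∃[ k ] Q k × ¬ Q (suc k)
  crossover Q? Q0 zero    ¬Q0 = contradiction Q0 ¬Q0
  crossover Q? Q0 (suc m) ¬Qm with Q? m
  ... | yes Qm = m , Qm , ¬Qm
  ... | no ¬Qm′ = crossover Q? Q0 m ¬Qm′

  ^-distribʳ-* : ∀ a b k → (a ℕ.* b) ℕ.^ k ≡ a ℕ.^ k ℕ.* b ℕ.^ k
  ^-distribʳ-* a b zero    = refl
  ^-distribʳ-* a b (suc k) = trans (cong (a ℕ.* b ℕ.*_) (^-distribʳ-* a b k))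
    (ℕ.[m*n]*[o*p]≡[m*o]*[n*p] a b (a ℕ.^ k) (b ℕ.^ k))

  -- The number of vertices from which `longPath` yields a path on k + 1 vertices.
  threshold : ℕ → ℕ
  threshold k = 2 ℕ.+ (suc k ℕ.* 2) ℕ.^ (k ℕ.* 2)

  n<threshold : ∀ n → n ℕ.< threshold n
  n<threshold zero = s≤s z≤n
  n<threshold n@(suc m) = s≤s (begin
    n                             ≤⟨ ℕ.m≤m*n n 2 ⟩
    n ℕ.* 2                       ≤⟨ ℕ.m≤n+m (n ℕ.* 2) 2 ⟩
    suc n ℕ.* 2                   ≡⟨ ℕ.*-identityʳ (suc n ℕ.* 2) ⟨
    (suc n ℕ.* 2) ℕ.^ 1           ≤⟨ ℕ.^-monoʳ-≤ (suc n ℕ.* 2) {1} {n ℕ.* 2} (s≤s z≤n) ⟩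
    (suc n ℕ.* 2) ℕ.^ (n ℕ.* 2)   ≤⟨ ℕ.n≤1+n ((suc n ℕ.* 2) ℕ.^ (n ℕ.* 2)) ⟩
    suc ((suc n ℕ.* 2) ℕ.^ (n ℕ.* 2))  ∎)
    where open ℕ.≤-Reasoning

  1+a^s≤a^[1+s] : ∀ a s → 2 ℕ.≤ a → suc (a ℕ.^ s) ℕ.≤ a ℕ.^ suc s
  1+a^s≤a^[1+s] a@(suc _) s 2≤a = begin
    1 ℕ.+ a ℕ.^ s            ≤⟨ ℕ.+-monoˡ-≤ (a ℕ.^ s) (ℕ.m^n>0 a s) ⟩
    a ℕ.^ s ℕ.+ a ℕ.^ s      ≡⟨ cong (λ x → a ℕ.^ s ℕ.+ x) (ℕ.+-identityʳ (a ℕ.^ s)) ⟨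
    2 ℕ.* a ℕ.^ s            ≤⟨ ℕ.*-monoˡ-≤ (a ℕ.^ s) 2≤a ⟩
    a ℕ.^ suc s              ∎
    where open ℕ.≤-Reasoning

  -- The last two conditions say w / 2 ≤ log₂ n ≤ 2 M log₂ (w / 2), so that
  -- log₂ n / (2 log₂ log₂ n) ≤ M.
  LogBound : ℕ → ℕ → ℕ → Set
  LogBound n M w = 2 ℕ.≤ w × 2 ℕ.^ w ℕ.≤ n ℕ.^ 2 × n ℕ.* 2 ℕ.^ (M ℕ.* 2) ℕ.≤ w ℕ.^ (M ℕ.* 2)

  -- The base h = 2k + 4 of `threshold (suc k)` serves as the estimate of log n, and w = 2h. From
  -- below, h ≤ 4k gives 2^h ≤ 4^(2k) ≤ (2k + 2)^(2k) ≤ n; from above, n ≤ h^(2k + 2) + 1 ≤ h^(2k +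
  -- 8).
  logBound-large : ∀ k {n} → 2 ℕ.≤ k → threshold k ℕ.≤ n → n ℕ.< threshold (suc k) →
                   LogBound n (4 ℕ.+ k) ((2 ℕ.+ k) ℕ.* 2 ℕ.* 2)
  logBound-large k {n} 2≤k low high = s≤s (s≤s z≤n) , 2^w≤n² , n2^N≤w^N
    where
    open ℕ.≤-Reasoning
    h s N : ℕ
    h = (2 ℕ.+ k) ℕ.* 2
    s = suc k ℕ.* 2
    N = (4 ℕ.+ k) ℕ.* 2
    h≤4k : h ℕ.≤ 2 ℕ.* (k ℕ.* 2)
    h≤4k = begin
      (2 ℕ.+ k) ℕ.* 2    ≤⟨ ℕ.*-monoˡ-≤ 2 (ℕ.+-monoˡ-≤ k 2≤k) ⟩
      (k ℕ.+ k) ℕ.* 2    ≡⟨ cong (λ x → (k ℕ.+ x) ℕ.* 2) (ℕ.+-identityʳ k) ⟨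
      2 ℕ.* k ℕ.* 2      ≡⟨ ℕ.*-assoc 2 k 2 ⟩
      2 ℕ.* (k ℕ.* 2)    ∎
    2^h≤n : 2 ℕ.^ h ℕ.≤ n
    2^h≤n = begin
      2 ℕ.^ h                        ≤⟨ ℕ.^-monoʳ-≤ 2 h≤4k ⟩
      2 ℕ.^ (2 ℕ.* (k ℕ.* 2))        ≡⟨ ℕ.^-*-assoc 2 2 (k ℕ.* 2) ⟨
      4 ℕ.^ (k ℕ.* 2)                ≤⟨ ℕ.^-monoˡ-≤ (k ℕ.* 2) (ℕ.*-monoˡ-≤ 2 (ℕ.≤-trans 2≤k (ℕ.n≤1+n k))) ⟩
      (suc k ℕ.* 2) ℕ.^ (k ℕ.* 2)    ≤⟨ ℕ.m≤n+m ((suc k ℕ.* 2) ℕ.^ (k ℕ.* 2)) 2 ⟩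
      threshold k                    ≤⟨ low ⟩
      n                              ∎
    n≤h^N : n ℕ.≤ h ℕ.^ N
    n≤h^N = begin
      n                  ≤⟨ ℕ.≤-pred high ⟩
      suc (h ℕ.^ s)      ≤⟨ 1+a^s≤a^[1+s] h s (s≤s (s≤s z≤n)) ⟩
      h ℕ.^ suc s        ≤⟨ ℕ.^-monoʳ-≤ h {suc s} {N} (ℕ.m≤n+m (suc s) 5) ⟩
      h ℕ.^ N            ∎
    2^w≤n² : 2 ℕ.^ (h ℕ.* 2) ℕ.≤ n ℕ.^ 2
    2^w≤n² = subst (ℕ._≤ n ℕ.^ 2) (ℕ.^-*-assoc 2 h 2) (ℕ.^-monoˡ-≤ 2 2^h≤n)
    n2^N≤w^N : n ℕ.* 2 ℕ.^ N ℕ.≤ (h ℕ.* 2) ℕ.^ N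
    n2^N≤w^N = subst (n ℕ.* 2 ℕ.^ N ℕ.≤_) (sym (^-distribʳ-* h 2 N)) (ℕ.*-monoˡ-≤ (2 ℕ.^ N) n≤h^N)

  -- For k < 2 the estimate 2k + 4 ≤ 4k fails, so `w` is chosen by hand for the ranges 3 ≤ n < 18
  -- and 18 ≤ n < 1298 and checked at their ends.
  logBound : ∀ k {n} → threshold k ℕ.≤ n → n ℕ.< threshold (suc k) → ∃[ w ] LogBound n (4 ℕ.+ k) w
  logBound 0 {n} 3≤n n<18 = 3 , s≤s (s≤s z≤n) ,
    ℕ.≤-trans (ℕ.≤ᵇ⇒≤ 8 9 _) (ℕ.^-monoˡ-≤ 2 3≤n) ,
    ℕ.≤-trans (ℕ.*-monoˡ-≤ (2 ℕ.^ 8) {n} {17} (ℕ.≤-pred n<18)) (ℕ.≤ᵇ⇒≤ (17 ℕ.* 2 ℕ.^ 8) (3 ℕ.^ 8) _)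
  logBound 1 {n} 18≤n n<1298 = 8 , s≤s (s≤s z≤n) ,
    ℕ.≤-trans (ℕ.≤ᵇ⇒≤ (2 ℕ.^ 8) (18 ℕ.^ 2) _) (ℕ.^-monoˡ-≤ 2 18≤n) ,
    ℕ.≤-trans (ℕ.*-monoˡ-≤ (2 ℕ.^ 10) {n} {1297} (ℕ.≤-pred n<1298)) (ℕ.≤ᵇ⇒≤ (1297 ℕ.* 2 ℕ.^ 10) (8 ℕ.^ 10) _)
  logBound k@(suc (suc _)) low high = _ , logBound-large k (s≤s (s≤s z≤n)) low high

  -- The constant 3 is the gap between the bound k + 4 on the ratio and the k + 1 vertices of the
  -- path.
  ratio-bound : ∀ {n k w ℓ} → 1 ℕ.≤ n → LogBound n (4 ℕ.+ k) w → suc k ℕ.≤ ℓ →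
                log₂ (fromℕ n) ÷ᶜ (ι 2 · log₂ (log₂ (fromℕ n))) -ᶜ fromℚ (ι 3) ≤ᶜ fromℕ ℓ
  ratio-bound {n} {k} {w} {ℓ} 1≤n (2≤w , 2^w≤n² , n2^N≤w^N) k<ℓ {q} (p , s , p<ratio , 3<s , q<p-s) =
    begin-strict
      q                  <⟨ q<p-s ⟩
      p - s              ≤⟨ ℚ.+-mono-≤ p≤ℓ+3 (ℚ.neg-antimono-≤ (ℚ.<⇒≤ 3<s)) ⟩
      ι ℓ + ι 3 - ι 3    ≡⟨ ℚ.+-assoc (ι ℓ) (ι 3) (ℚ.- ι 3) ⟩
      ι ℓ + (ι 3 - ι 3)  ≡⟨ cong (λ x → ι ℓ + x) (ℚ.+-inverseʳ (ι 3)) ⟩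
      ι ℓ + 0ℚ           ≡⟨ ℚ.+-identityʳ (ι ℓ) ⟩
      ι ℓ                ∎
    where
    open ℚ.≤-Reasoning
    4+k≤ℓ+3 : 4 ℕ.+ k ℕ.≤ ℓ ℕ.+ 3
    4+k≤ℓ+3 = subst (ℕ._≤ ℓ ℕ.+ 3) (ℕ.+-comm (suc k) 3) (ℕ.+-monoˡ-≤ 3 k<ℓ)
    p≤ℓ+3 : p ≤ ι ℓ + ι 3
    p≤ℓ+3 = begin
      p                ≤⟨ ratio-upper n w (4 ℕ.+ k) 1≤n 2≤w 2^w≤n² n2^N≤w^N p<ratio ⟩
      ι (4 ℕ.+ k)      ≤⟨ ι-mono-≤ 4+k≤ℓ+3 ⟩
      ι (ℓ ℕ.+ 3)      ≡⟨ ι-+ ℓ 3 ⟩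
      ι ℓ + ι 3        ∎

-- From vertex numbers back to ordered graphs.

module Graphs where

  open import Data.Fin as Fin using (toℕ)
  import Data.Fin.Properties as Fin
  open import Data.Nat as ℕ using (ℕ; suc; z≤n; s≤s)
  open import Data.Nat.DivMod using (_mod_; m<n⇒m%n≡m; m%n<n)
  import Data.Nat.Properties as ℕ
  open import Data.Product using (Σ; ∃-syntax; _×_; _,_)
  open import Data.Sum using (_⊎_; inj₁; inj₂)
  open import Data.Vec.Functional using (Vector)
  open import Function using (_∘_)
  open import Relation.Binary.Definitions using (tri<; tri≈; tri>)
  open import Relation.Binary.PropositionalEquality
  open import Relation.Binary.Structures using (IsStrictTotalOrder)
  open import Relation.Nullary using (¬_; contradiction)
  open Chains

  toℕ-mod : ∀ {i n} .{{_ : ℕ.NonZero n}} → i ℕ.< n → toℕ (i mod n) ≡ i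
  toℕ-mod {i} {n} i<n = trans (Fin.toℕ-fromℕ< (m%n<n i n)) (m<n⇒m%n≡m i<n)

  module _ {n : ℕ} .{{_ : ℕ.NonZero n}} (G : OrderedGraph n) (P : Vector (OrderedGraph.V G) n) where
    open OrderedGraph G

    -- Reduction mod `n` makes the numbering total on `ℕ`; indices below `n` are unchanged.
    vertex : ℕ → V
    vertex i = P (i mod n)

    module _ (P-increasing : IsIncreasing G P) where

      vertex-mono : ∀ {i j} → i ℕ.< j → j ℕ.< n → vertex i ≺ vertex j
      vertex-mono {i} {j} i<j j<n = P-increasing (subst₂ ℕ._<_
        (sym (toℕ-mod (ℕ.<-trans i<j j<n))) (sym (toℕ-mod j<n)) i<j)

      open IsChain

      chain⇒increasing : ∀ {ℓ} {u : Vector ℕ ℓ} → IsChain n ℕ._<_ (λ i j → vertex i ~ vertex j) u →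
                         IsIncreasing G (vertex ∘ u)
      chain⇒increasing c {j = j} i<j = vertex-mono (c .ordered i<j) (c .bounded j)

      -- Injectivity comes from monotonicity, and edges that run backwards are turned round by
      -- symmetry.
      chain⇒inducedPath : ∀ {ℓ} {u : Vector ℕ (suc ℓ)} →
                          IsChain n ℕ._<_ (λ i j → vertex i ~ vertex j) u →
                          IsInducedPath G (vertex ∘ u)
      chain⇒inducedPath {u = u} c = record
        { isPath = record { nonempty = s≤s z≤n ; injective = inj ; adjacent = c .linked }
        ; chordless = chordless′
        }
        where
        irrefl : ∀ {x y} → x ≡ y → ¬ x ≺ y
        irrefl = IsStrictTotalOrder.irrefl ≺-total
        inj : ∀ {i j} → vertex (u i) ≡ vertex (u j) → i ≡ j
        inj {i} {j} eq with Fin.<-cmp i j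
        ... | tri< i<j _ _ = contradiction (chain⇒increasing c i<j) (irrefl eq)
        ... | tri≈ _ i≡j _ = i≡j
        ... | tri> _ _ j<i = contradiction (chain⇒increasing c j<i) (irrefl (sym eq))
        chordless′ : ∀ {i j} → vertex (u i) ~ vertex (u j) → Consecutive G i j ⊎ Consecutive G j i
        chordless′ {i} {j} uᵢ~uⱼ with Fin.<-cmp i j
        ... | tri< i<j _ _  = inj₁ (c .chordless i<j uᵢ~uⱼ)
        ... | tri≈ _ refl _ = contradiction uᵢ~uⱼ (~-irrefl refl)
        ... | tri> _ _ j<i  = inj₂ (c .chordless j<i (~-sym uᵢ~uⱼ))

    inducedPath : IsOrderedAlong G P → Is2NonCrossing G →
                  ∀ k → 2 ℕ.+ (suc k ℕ.* 2) ℕ.^ (k ℕ.* 2) ℕ.≤ n →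
                  ∃[ ℓ ] suc k ℕ.≤ ℓ ×
                  Σ (Vector V ℓ) λ u → IsInducedPath G u × IsIncreasing G u
    inducedPath (hamiltonian , increasing) (S , T , cover , _ , ncS , ncT) k big
      with longPath (λ i j → vertex i ~? vertex j) step cover (noCrossing S ncS) (noCrossing T ncT) k big
      where
      step : ∀ {i} → suc i ℕ.< n → vertex i ~ vertex (suc i)
      step {i} 1+i<n = IsHamiltonianPath.isPath hamiltonian .IsPath.adjacent
        (trans (toℕ-mod 1+i<n) (cong suc (sym (toℕ-mod (ℕ.<-trans ℕ.≤-refl 1+i<n)))))
      noCrossing : (R : EdgeSet G) → IsNonCrossing G R → ∀ {a b c d} → a ℕ.< c → c ℕ.< b → b ℕ.< d → d ℕ.< n →
                   EdgeSet.mem R (vertex a) (vertex b) → ¬ EdgeSet.mem R (vertex c) (vertex d)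
      noCrossing R nc a<c c<b b<d d<n Rab Rcd = nc Rab Rcd
        ( vertex-mono increasing a<c (ℕ.<-trans c<b (ℕ.<-trans b<d d<n))
        , vertex-mono increasing c<b (ℕ.<-trans b<d d<n)
        , vertex-mono increasing b<d d<n )
    ... | ℓ , k≤ℓ , u , c =
      suc ℓ , s≤s k≤ℓ , vertex ∘ u , chain⇒inducedPath increasing c , chain⇒increasing increasing c

open import Data.Integer using (+_)
open import Data.Nat using (ℕ; _≤_; z≤n; s≤s; _≤?_; >-nonZero)
open import Data.Nat.Properties using (≤-trans; <⇒≱; ≰⇒>)
open import Data.Product using (Σ; _×_; _,_)
open import Data.Rational using (ℚ; _/_)
open import Data.Vec.Functional using (Vector)
open Logarithms
open Graphs

theorem3p6 : Σ ℚ λ C →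
    ∀ (n : ℕ) → 3 ≤ n →
    (G : OrderedGraph n) (P : Vector (OrderedGraph.V G) n) →
    IsOrderedAlong G P →
    Is2NonCrossing G →
    Σ ℕ λ ℓ → Σ (Vector (OrderedGraph.V G) ℓ) λ u →
    IsInducedPath G u ×
    IsIncreasing G u ×
    log₂ (fromℕ n) ÷ᶜ ((+ 2 / 1) · log₂ (log₂ (fromℕ n))) -ᶜ fromℚ C ≤ᶜ fromℕ ℓ
theorem3p6 = + 3 / 1 , λ n 3≤n G P along pages →
  let 1≤n = ≤-trans (s≤s z≤n) 3≤n
      -- `threshold 0` is 3, so the hypothesis on `n` is the true end of the search; the false end
      -- is `n` itself.
      k , low , high = crossover (λ k → threshold k ≤? n) 3≤n n (<⇒≱ (n<threshold n))
      ℓ , k<ℓ , u , induced , increasing = inducedPath {{>-nonZero 1≤n}} G P along pages k low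
      w , bound = logBound k low (≰⇒> high)
  in ℓ , u , induced , increasing , λ {q} → ratio-bound {n} {k} {w} 1≤n bound k<ℓ {q}
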